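{- Let $q\ge 2$ and $k\ge 1$ be fixed integers and let $\Gamma$ be a finite, non-trivial constraint language consisting of $k$-ary relations over $[q]=\{0,1,\dots,q-1\}$. Then, for deciding satisfiability of instances of $\mathsf{CSP}(\Gamma)$ on $n$ variables presented as a single-pass stream of constraints: (a) there exists a deterministic single-pass streaming algorithm using $O_{q,k}(\mathsf{NRD}_n(\Gamma)\log n)$ bits of space; and (b) no randomized single-pass streaming algorithm (succeeding with probability at least $2/3$ on every input) uses $o(\mathsf{NRD}_n(\Gamma))$ bits of space.
   Context: An instance of $\mathsf{CSP}(\Gamma)$ on variables $x_1,\dots,x_n$ taking values in $[q]$ is a finite set of constraints, each of the form $\{R,(x_{i_1}+\lambda_{i_1},\dots,x_{i_k}+\lambda_{i_k})\}$ with $R\in\Gamma$, $(i_1,\dots,i_k)\in[n]^k$ and shifts $\lambda_{i_j}\in[q]$; an assignment $a\in[q]^n$ satisfies it if $(a_{i_1}+\lambda_{i_1},\dots,a_{i_k}+\lambda_{i_k})\in R$, with arithmetic modulo $q$. $\mathrm{Sat}(I)$ is the set of assignments satisfying every constraint of $I$; $I$ is satisfiable if $\mathrm{Sat}(I)\neq\emptyset$. A constraint $C\in I$ is redundant if $\mathrm{Sat}(I\setminus\{C\})=\mathrm{Sat}(I)$; $I$ is non-redundant if none of its constraints is redundant. $\mathsf{NRD}_n(\Gamma)$ is the maximum number of constraints in a non-redundant instance of $\mathsf{CSP}(\Gamma)$ on $n$ variables. $\Gamma$ is non-trivial if every relation in $\Gamma$ is non-empty and at least one relation in $\Gamma$ is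 a proper subset of $[q]^k$. In the streaming model the constraints arrive one at a time and at the end the algorithm must output whether the instance is satisfiable; a deterministic algorithm must always be correct, a randomized one correct with probability at least $2/3$ on every input. Hidden constants may depend on $q$, $k$ and $\Gamma$. -}

module Defs where

open import Data.Bool.Base using (Bool; true; false)
import Data.Bool.Properties as Bool
open import Data.Fin.Base using (Fin; toℕ)
import Data.Fin.Properties as Fin
open import Data.List.Base as List using (List; []; _∷_; [_]; length; filter; foldl; allFin; cartesianProduct; cartesianProductWith)
open import Data.List.Membership.Propositional using (_∈_; find; lose)
open import Data.List.Membership.Propositional.Properties using (∈-allFin; ∈-cartesianProduct⁺; ∈-cartesianProductWith⁺; ∈-lookup)
import Data.List.Membership.Setoid.Properties as Membershipₛ
open import Data.List.Relation.Unary.All as All using (All; []; _∷_)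
open import Data.List.Relation.Unary.AllPairs using ([]; _∷_)
open import Data.List.Relation.Unary.Any using (here; index; any?)
open import Data.List.Relation.Unary.Unique.Propositional using (Unique)
import Data.List.Relation.Unary.Unique.DecPropositional as UniqueDec
open import Data.Nat.Base using (ℕ; zero; suc; _+_; _*_; _≤_)
open import Data.Nat.DivMod using (_mod_)
import Data.Nat.Properties as ℕ
open import Data.Product.Base using (∃; ∃-syntax; _×_; _,_; proj₁; proj₂; map₂)
import Data.Product.Properties as Product
open import Data.Vec.Base as Vec using (Vec; []; _∷_; lookup; toList; fromList)
import Data.Vec.Properties as Vec
open import Function.Base using (_∘_)
open import Function.Bundles using (_⇔_; mk⇔; Equivalence)
open import Level using (0ℓ)
open import Relation.Binary.Definitions using (DecidableEquality)
open import Relation.Binary.PropositionalEquality using (_≡_; _≗_; refl; sym; cong; subst; setoid)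
open import Relation.Nullary.Decidable using (Dec; yes; no; does; map′; _×-dec_; _→-dec_; ¬?)
open import Relation.Nullary.Negation using (¬_; contradiction)
open import Relation.Unary using (Pred; Decidable)

infixl 6 _⊕_
infix  4 _is-O_ _is-o_

_is-O_ : (f g : ℕ → ℕ) → Set
f is-O g = ∃[ C ] ∃[ n₀ ] (∀ n → n₀ ≤ n → f n ≤ C * g n)

-- "f ≤ ε g eventually, for every ε > 0"; taking ε = 1/c suffices.
_is-o_ : (f g : ℕ → ℕ) → Set
f is-o g = ∀ c → ∃[ n₀ ] (∀ n → n₀ ≤ n → c * f n ≤ g n)

IsMaximum : Pred ℕ 0ℓ → Pred ℕ 0ℓ
IsMaximum P m = P m × (∀ m′ → P m′ → m′ ≤ m)

Relation : (q k : ℕ) → Set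
Relation q k = Vec (Fin q) k → Bool

-- A finite set of relations, listed without repetition (relations being
-- compared extensionally).
record Language (q k : ℕ) : Set where
  field
    size     : ℕ
    relation : Fin size → Relation q k
    distinct : ∀ {i j} → relation i ≗ relation j → i ≡ j

open Language public

NonTrivial : ∀ {q k} → Language q k → Set
NonTrivial Γ = (∀ i → ∃[ t ] relation Γ i t ≡ true)
             × (∃[ i ] ∃[ t ] relation Γ i t ≡ false)

_⊕_ : ∀ {q} → Fin q → Fin q → Fin q
_⊕_ {q} a b = _mod_ (toℕ a + toℕ b) q {{Fin.nonZeroIndex a}}

allVecs : ∀ {A : Set} → List A → ∀ m → List (Vec A m)
allVecs xs zero    = [ [] ]
allVecs xs (suc m) = cartesianProductWith _∷_ xs (allVecs xs m)

∈-allVecs : ∀ {A : Set} {xs : List A} → (∀ x → x ∈ xs) →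
            ∀ {m} (v : Vec A m) → v ∈ allVecs xs m
∈-allVecs enum []      = here refl
∈-allVecs enum (x ∷ v) = ∈-cartesianProductWith⁺ _∷_ (enum x) (∈-allVecs enum v)

module _ {A : Set} {xs : List A} {P : Pred A 0ℓ}
         (enum : ∀ x → x ∈ xs) (P? : Decidable P) where

  enum-any? : Dec (∃ P)
  enum-any? = map′ (λ p → map₂ proj₂ (find p)) (λ (x , px) → lose (enum x) px)
                   (any? P? xs)

  enum-all? : Dec (∀ x → P x)
  enum-all? = map′ (λ ps x → All.lookup ps (enum x)) (λ f → All.tabulate λ {x} _ → f x)
                   (All.all? P? xs)

unique-length≤ : ∀ {A : Set} {xs : List A} → (∀ x → x ∈ xs) →
                 ∀ {ys : List A} → Unique ys → length ys ≤ length xs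
unique-length≤ {A} {xs} enum {ys} ys! =
  Fin.injective⇒≤ {f = index ∘ enum ∘ List.lookup ys} λ {i} {j} eq →
    lookup-injective ys! i j
      (Membershipₛ.index-injective (setoid A) (enum _) (enum _) eq)
  where
  lookup-injective : ∀ {zs : List A} → Unique zs → ∀ i j →
                     List.lookup zs i ≡ List.lookup zs j → i ≡ j
  lookup-injective (_   ∷ _)   Fin.zero    Fin.zero    _  = refl
  lookup-injective (z∉  ∷ _)   Fin.zero    (Fin.suc j) eq =
    contradiction eq (All.lookup z∉ (∈-lookup j))
  lookup-injective (z∉  ∷ _)   (Fin.suc i) Fin.zero    eq =
    contradiction (sym eq) (All.lookup z∉ (∈-lookup i))
  lookup-injective (_   ∷ zs!) (Fin.suc i) (Fin.suc j) eq =
    cong Fin.suc (lookup-injective zs! i j eq)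

maximum : ∀ {P : Pred ℕ 0ℓ} → Decidable P → P 0 → ∀ b → (∀ m → P m → m ≤ b) →
          ∃ (IsMaximum P)
maximum P? p₀ zero    bound = 0 , p₀ , bound
maximum P? p₀ (suc b) bound with P? (suc b)
... | yes p = suc b , p , bound
... | no ¬p = maximum P? p₀ b λ m pm →
  ℕ.≤-pred (ℕ.≤∧≢⇒< (bound m pm) λ { refl → ¬p pm })

Memory : ℕ → Set
Memory s = Vec Bool s

module CSP {q k : ℕ} (Γ : Language q k) (n : ℕ) where

  -- (r , (i₁ , λ₁) ∷ … ∷ (iₖ , λₖ) ∷ []) is the constraint that
  -- (x_{i₁} + λ₁ , … , x_{iₖ} + λₖ) lies in the r-th relation of Γ.
  Constraint : Set
  Constraint = Fin (size Γ) × Vec (Fin n × Fin q) k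

  -- A list stands for the set of its members, and is at the same time a stream
  -- of constraints; it may repeat a constraint.  When the size of the set
  -- matters (in NRD) the list is required to be duplicate-free.
  Instance : Set
  Instance = List Constraint

  Assignment : Set
  Assignment = Vec (Fin q) n

  Satisfies : Assignment → Constraint → Set
  Satisfies a (r , vs) =
    relation Γ r (Vec.map (λ (i , s) → lookup a i ⊕ s) vs) ≡ true

  Sat : Instance → Pred Assignment 0ℓ
  Sat I a = All (Satisfies a) I

  Satisfiable : Instance → Set
  Satisfiable I = ∃ (Sat I)

  infix 4 _≟_
  _≟_ : DecidableEquality Constraint
  _≟_ = Product.≡-dec Fin._≟_ (Vec.≡-dec (Product.≡-dec Fin._≟_ Fin._≟_))

  infixl 6 _∖_
  _∖_ : Instance → Constraint → Instance
  I ∖ C = filter (λ D → ¬? (D ≟ C)) I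

  Redundant : Instance → Constraint → Set
  Redundant I C = ∀ a → Sat (I ∖ C) a ⇔ Sat I a

  NonRedundant : Instance → Set
  NonRedundant I = All (λ C → ¬ Redundant I C) I

  sat? : ∀ I → Decidable (Sat I)
  sat? I a = All.all? (λ C → _ Bool.≟ true) I

  ∈-assignments : ∀ a → a ∈ allVecs (allFin q) n
  ∈-assignments = ∈-allVecs ∈-allFin

  satisfiable? : Decidable Satisfiable
  satisfiable? I = enum-any? ∈-assignments (sat? I)

  nonRedundant? : Decidable NonRedundant
  nonRedundant? I = All.all? (λ C → ¬? (enum-all? ∈-assignments λ a →
    map′ (λ (f , g) → mk⇔ f g) (λ e → Equivalence.to e , Equivalence.from e)
         ((sat? (I ∖ C) a →-dec sat? I a) ×-dec (sat? I a →-dec sat? (I ∖ C) a)))) I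

  HasNonRedundantOfSize : Pred ℕ 0ℓ
  HasNonRedundantOfSize m =
    ∃[ I ] Unique I × NonRedundant I × length I ≡ m

  private
    constraints : List Constraint
    constraints = cartesianProduct (allFin (size Γ))
                    (allVecs (cartesianProduct (allFin n) (allFin q)) k)

    ∈-constraints : ∀ C → C ∈ constraints
    ∈-constraints (r , vs) = ∈-cartesianProduct⁺ (∈-allFin r)
      (∈-allVecs (λ (i , s) → ∈-cartesianProduct⁺ (∈-allFin i) (∈-allFin s)) vs)

    hasNonRedundantOfSize? : Decidable HasNonRedundantOfSize
    hasNonRedundantOfSize? m = map′
      (λ (v , u , nr) → toList v , u , nr , Vec.length-toList v)
      (λ { (I , u , nr , refl) → fromList I
                               , subst Unique (sym (Vec.toList∘fromList I)) u
                               , subst NonRedundant (sym (Vec.toList∘fromList I)) nr })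
      (enum-any? {P = λ (v : Vec _ m) → Unique (toList v) × NonRedundant (toList v)}
        (∈-allVecs ∈-constraints)
        (λ v → UniqueDec.unique? _≟_ (toList v) ×-dec nonRedundant? (toList v)))

  nrd-exists : ∃ (IsMaximum HasNonRedundantOfSize)
  nrd-exists = maximum hasNonRedundantOfSize? ([] , [] , [] , refl) (length constraints)
    λ { m (I , u , _ , refl) → unique-length≤ ∈-constraints u }

  NRD : ℕ
  NRD = proj₁ nrd-exists

  NRD-isMaximum : IsMaximum HasNonRedundantOfSize NRD
  NRD-isMaximum = proj₂ nrd-exists

  -- The space of an algorithm is the number of bits it carries from one
  -- stream item to the next.
  record DeterministicAlgorithm (s : ℕ) : Set where
    field
      start  : Memory s
      step   : Memory s → Constraint → Memory s
      output : Memory s → Bool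

    run : Instance → Bool
    run I = output (foldl step start I)

    Correct : Set
    Correct = ∀ I → run I ≡ does (satisfiable? I)

  -- At the start and on the arrival of every stream item the algorithm draws a
  -- fresh uniformly random element of Fin (suc d).  Reading the random draws
  -- made so far (most recent first) is free of charge, so that both private
  -- coins (use only the head) and public coins are covered, as is dependence on
  -- the position in the stream.
  record RandomizedAlgorithm (s : ℕ) : Set where
    field
      d : ℕ

    Draw : Set
    Draw = Fin (suc d)

    field
      start  : List Draw → Memory s
      step   : List Draw → Memory s → Constraint → Memory s
      output : List Draw → Memory s → Bool

    runFrom : List Draw → Memory s → (I : Instance) → Vec Draw (length I) → Bool
    runFrom past μ []      []       = output past μ
    runFrom past μ (C ∷ I) (ω ∷ ωs) = runFrom (ω ∷ past) (step (ω ∷ past) μ C) I ωs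

    run : (I : Instance) → Vec Draw (suc (length I)) → Bool
    run I (ω ∷ ωs) = runFrom [ ω ] (start [ ω ]) I ωs

    draws : (I : Instance) → List (Vec Draw (suc (length I)))
    draws I = allVecs (allFin (suc d)) (suc (length I))

    correctDraws : (I : Instance) → List (Vec Draw (suc (length I)))
    correctDraws I = filter (λ ωs → run I ωs Bool.≟ does (satisfiable? I)) (draws I)

    -- Pr[correct] = |correctDraws| / |draws| ≥ 2/3, denominators cleared.
    Succeeds : Set
    Succeeds = ∀ I → 2 * length (draws I) ≤ 3 * length (correctDraws I)

{-# OPTIONS --safe #-}
module Submission where

open import Data.Bool.Base using (Bool; true; false; if_then_else_)
import Data.Bool.Properties as Bool
open import Data.Fin.Base using (Fin; zero; suc; toℕ)
import Data.Fin.Properties as Fin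
open import Data.List.Base as List using (List; []; _∷_; [_]; _++_; length; map; filter; foldl; take; drop; deduplicate; allFin; cartesianProduct; cartesianProductWith)
open import Data.List.Membership.Propositional using (_∈_; find; lose)
open import Data.List.Membership.Propositional.Properties using (∈-allFin; ∈-cartesianProduct⁺; ∈-filter⁺; ∈-length; ∈-lookup; ∈-++⁻; ∈-deduplicate⁺; ∈-deduplicate⁻)
open import Data.List.Properties using (length-map; length-++; length-tabulate; length-take; length-drop; take++drop≡id; filter-notAll)
open import Data.List.Relation.Unary.All as All using (All; []; _∷_)
import Data.List.Relation.Unary.All.Properties as All
open import Data.List.Relation.Unary.AllPairs using ([]; _∷_)
open import Data.List.Relation.Unary.Any using (here; there)
open import Data.List.Relation.Unary.Unique.DecPropositional.Properties using (deduplicate-!)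
open import Data.List.Relation.Unary.Unique.Propositional using (Unique)
import Data.List.Relation.Unary.Unique.Propositional.Properties as Unique
open import Data.Nat.Base hiding (NonTrivial)
open import Data.Nat.DivMod using (_%_; _mod_; m%n<n; m%n%n≡m%n; m<n⇒m%n≡m; [m+n]%n≡m%n; [m+kn]%n≡m%n; %-distribˡ-+)
open import Data.Nat.GeneralisedArithmetic using (fold)
open import Data.Nat.Induction using (<-wellFounded)
open import Data.Nat.Logarithm using (⌈log₂_⌉; ⌈log₂⌉-mono-≤)
open import Data.Nat.Logarithm.Core using (⌈log2⌉)
open import Data.Nat.Properties hiding (_≟_)
open import Data.Nat.Tactic.RingSolver using (solve-∀)
open import Data.Product.Base using (Σ-syntax; ∃-syntax; _×_; _,_; proj₁; proj₂)
open import Data.Sum.Base using (inj₁; inj₂)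
open import Data.Vec.Base as Vec using (Vec; []; _∷_; lookup; toList)
import Data.Vec.Properties as Vec
open import Function.Base using (_∘_; case_of_)
open import Function.Bundles using (_⇔_; mk⇔; Equivalence)
open import Function.Construct.Composition using (_⇔-∘_)
open import Function.Construct.Identity using (⇔-id)
open import Induction.WellFounded using (acc)
open import Level using (0ℓ)
open import Relation.Binary.PropositionalEquality using (_≡_; _≢_; refl; sym; trans; cong; cong₂; subst; module ≡-Reasoning)
open import Relation.Nullary.Decidable using (Dec; yes; no; does; map′; ¬?; _×-dec_; _→-dec_; dec-true; dec-false; does-⇔; decidable-stable; toWitness)
open import Relation.Nullary.Negation using (¬_; contradiction)
open import Relation.Unary using (Pred; Decidable)
open import Defs

-- (a) The algorithm stores a non-redundant instance with the same solutions as
-- the stream read so far: at most NRD constraints of O(log n) bits each.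
--
-- (b) Let I be a non-redundant instance and let a_C satisfy I ∖ C but not C.
-- Alice streams a subset of I; to learn whether it contains C, Bob appends every
-- constraint satisfied by a_C.  Each solution b of Bob's constraints satisfies
-- exactly the same constraints as a_C: for a k-tuple of variables, the shifts λ
-- with b + λ ∈ R include those with a_C + λ ∈ R, and both sets have |R| elements.
-- Hence the result is satisfiable iff Alice's subset omits C, and the space is at
-- least the communication complexity of INDEX.  For the latter, if a message μ
-- makes Bob guess the string g(μ), then the sum over all S of
-- (3/2)^(#agreements − 2 #disagreements) of g(μ) with S is (3/2 + 4/9)^M, while
-- success probability 2/3 and convexity make the sum over S, with μ sent on S, at
-- least 2^M on average over the coins; so 2^s ≥ (36/35)^M.

-- Finite sums

module _ {A : Set} where

  ∑ : List A → (A → ℕ) → ℕ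
  ∑ []       f = 0
  ∑ (x ∷ xs) f = f x + ∑ xs f

  ∑-mono : ∀ xs {f g : A → ℕ} → (∀ x → f x ≤ g x) → ∑ xs f ≤ ∑ xs g
  ∑-mono []       f≤g = z≤n
  ∑-mono (x ∷ xs) f≤g = +-mono-≤ (f≤g x) (∑-mono xs f≤g)

  ∑-++ : ∀ xs ys (f : A → ℕ) → ∑ (xs ++ ys) f ≡ ∑ xs f + ∑ ys f
  ∑-++ []       ys f = refl
  ∑-++ (x ∷ xs) ys f = trans (cong (f x +_) (∑-++ xs ys f)) (sym (+-assoc (f x) _ _))

  ∑-+ : ∀ xs (f g : A → ℕ) → ∑ xs (λ x → f x + g x) ≡ ∑ xs f + ∑ xs g
  ∑-+ []       f g = refl
  ∑-+ (x ∷ xs) f g = trans (cong (f x + g x +_) (∑-+ xs f g)) (interchange (f x) (g x) _ _)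
    where
    interchange : ∀ a b c d → a + b + (c + d) ≡ a + c + (b + d)
    interchange = solve-∀

  ∑-*ˡ : ∀ xs c (f : A → ℕ) → ∑ xs (λ x → c * f x) ≡ c * ∑ xs f
  ∑-*ˡ []       c f = sym (*-zeroʳ c)
  ∑-*ˡ (x ∷ xs) c f = trans (cong (c * f x +_) (∑-*ˡ xs c f)) (sym (*-distribˡ-+ c (f x) _))

  ∑-const : ∀ (xs : List A) c → ∑ xs (λ _ → c) ≡ length xs * c
  ∑-const []       c = refl
  ∑-const (x ∷ xs) c = cong (c +_) (∑-const xs c)

  ∈⇒≤∑ : ∀ {x xs} (f : A → ℕ) → x ∈ xs → f x ≤ ∑ xs f
  ∈⇒≤∑ f (here refl) = m≤m+n _ _
  ∈⇒≤∑ f (there x∈)  = m≤n⇒m≤o+n _ (∈⇒≤∑ f x∈)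

  length-filter≡∑ : ∀ {P : Pred A 0ℓ} (P? : Decidable P) xs →
                    length (filter P? xs) ≡ ∑ xs (λ x → if does (P? x) then 1 else 0)
  length-filter≡∑ P? []       = refl
  length-filter≡∑ P? (x ∷ xs) with does (P? x)
  ... | true  = cong suc (length-filter≡∑ P? xs)
  ... | false = length-filter≡∑ P? xs

module _ {A B : Set} where

  ∑-map : ∀ (h : A → B) xs f → ∑ (map h xs) f ≡ ∑ xs (f ∘ h)
  ∑-map h []       f = refl
  ∑-map h (x ∷ xs) f = cong (f (h x) +_) (∑-map h xs f)

  ∑-swap : ∀ xs ys (f : A → B → ℕ) →
           ∑ xs (λ x → ∑ ys (f x)) ≡ ∑ ys (λ y → ∑ xs (λ x → f x y))
  ∑-swap []       ys f = sym (trans (∑-const ys 0) (*-zeroʳ (length ys)))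
  ∑-swap (x ∷ xs) ys f = trans (cong (∑ ys (f x) +_) (∑-swap xs ys f))
                               (sym (∑-+ ys (f x) _))

-- The INDEX problem

bools : List Bool
bools = false ∷ true ∷ []

∈-bools : ∀ b → b ∈ bools
∈-bools false = here refl
∈-bools true  = there (here refl)

∑-allVecs-suc : ∀ m (f : Vec Bool (suc m) → ℕ) →
  ∑ (allVecs bools (suc m)) f ≡
  ∑ (allVecs bools m) (f ∘ (false ∷_)) + ∑ (allVecs bools m) (f ∘ (true ∷_))
∑-allVecs-suc m f = begin
  ∑ (map (false ∷_) V ++ map (true ∷_) V ++ []) f                ≡⟨ ∑-++ (map (false ∷_) V) _ f ⟩
  ∑ (map (false ∷_) V) f + ∑ (map (true ∷_) V ++ []) f           ≡⟨ cong₂ _+_ (∑-map _ V f) (∑-++ (map (true ∷_) V) [] f) ⟩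
  ∑ V (f ∘ (false ∷_)) + (∑ (map (true ∷_) V) f + 0)             ≡⟨ cong (∑ V (f ∘ (false ∷_)) +_) (trans (+-identityʳ _) (∑-map _ V f)) ⟩
  ∑ V (f ∘ (false ∷_)) + ∑ V (f ∘ (true ∷_))                     ∎
  where
  open ≡-Reasoning
  V = allVecs bools m

length-allVecs-bools : ∀ m → length (allVecs bools m) ≡ 2 ^ m
length-allVecs-bools m = begin
  length V           ≡⟨ *-identityʳ _ ⟨
  length V * 1       ≡⟨ ∑-const V 1 ⟨
  ∑ V (λ _ → 1)      ≡⟨ ∑-1 m ⟩
  2 ^ m              ∎
  where
  open ≡-Reasoning
  V = allVecs bools m
  ∑-1 : ∀ m → ∑ (allVecs bools m) (λ _ → 1) ≡ 2 ^ m
  ∑-1 zero    = refl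
  ∑-1 (suc m) = trans (∑-allVecs-suc m _)
    (cong₂ _+_ (∑-1 m) (trans (∑-1 m) (sym (+-identityʳ _))))

hit : Bool → Bool → ℕ
hit b c = if does (b Bool.≟ c) then 1 else 0

hits : ∀ {M} → (Fin M → Bool) → Vec Bool M → ℕ
hits g []      = 0
hits g (b ∷ S) = hit (g zero) b + hits (g ∘ suc) S

-- With y = hits − 2 · misses, weight is 18 ^ M · (3/2) ^ y: the expectation of
-- y is non-negative when every bit is guessed with probability ≥ 2/3, while
-- 3/2 + (3/2)⁻² < 2.
weight : ∀ {M} → (Fin M → Bool) → Vec Bool M → ℕ
weight g []      = 1
weight g (b ∷ S) = (if does (g zero Bool.≟ b) then 27 else 8) * weight (g ∘ suc) S

-- The sum factors over coordinates, and each bit contributes `27 + 8` whichever way it is guessed;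
-- hence the value does not depend on `g`.
∑-weight : ∀ {M} (g : Fin M → Bool) → ∑ (allVecs bools M) (weight g) ≡ 35 ^ M
∑-weight {zero}  g = refl
∑-weight {suc M} g = begin
  ∑ (allVecs bools (suc M)) (weight g)           ≡⟨ ∑-allVecs-suc M (weight g) ⟩
  ∑ V (weight g ∘ (false ∷_)) + ∑ V (weight g ∘ (true ∷_))
                                                 ≡⟨ cong₂ _+_ (∑-*ˡ V (u false) _) (∑-*ˡ V (u true) _) ⟩
  u false * T + u true * T                       ≡⟨ *-distribʳ-+ T (u false) (u true) ⟨
  (u false + u true) * T                         ≡⟨ cong₂ _*_ (u-sum (g zero)) (∑-weight (g ∘ suc)) ⟩
  35 ^ suc M                                     ∎
  where
  open ≡-Reasoning
  V = allVecs bools M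
  T = ∑ V (weight (g ∘ suc))
  u : Bool → ℕ
  u b = if does (g zero Bool.≟ b) then 27 else 8
  u-sum : ∀ c → (if does (c Bool.≟ false) then 27 else 8) + (if does (c Bool.≟ true) then 27 else 8) ≡ 35
  u-sum false = refl
  u-sum true  = refl

-- Bernoulli's inequality `(3/2) ^ c ≥ 1 + c / 2`, the miss-free case of `tangent`.
bernoulli : ∀ c → 18 ^ c * (2 + c) ≤ 2 * 27 ^ c
bernoulli zero    = ≤-refl
bernoulli (suc c) = begin
  18 * x * (3 + c)         ≤⟨ m≤m+n _ (9 * c * x) ⟩
  18 * x * (3 + c) + 9 * c * x ≡⟨ regroup x c ⟩
  27 * (x * (2 + c))       ≤⟨ *-monoʳ-≤ 27 (bernoulli c) ⟩
  27 * (2 * 27 ^ c)        ≡⟨ swap₂ (27 ^ c) ⟩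
  2 * (27 * 27 ^ c)        ∎
  where
  open ≤-Reasoning
  x = 18 ^ c
  regroup : ∀ x c → 18 * x * (3 + c) + 9 * c * x ≡ 27 * (x * (2 + c))
  regroup = solve-∀
  swap₂ : ∀ y → 27 * (2 * y) ≡ 2 * (27 * y)
  swap₂ = solve-∀

-- (3/2) ^ y ≥ 1 + y / 2 for the integer y = c − 2 w, denominators cleared.
tangent : ∀ c w → 18 ^ (c + w) * (2 + c) ≤ 2 * (27 ^ c * 8 ^ w) + 18 ^ (c + w) * (2 * w)
tangent c zero = begin
  18 ^ (c + 0) * (2 + c)   ≡⟨ cong (λ e → 18 ^ e * (2 + c)) (+-identityʳ c) ⟩
  18 ^ c * (2 + c)         ≤⟨ bernoulli c ⟩
  2 * 27 ^ c               ≡⟨ cong (2 *_) (*-identityʳ (27 ^ c)) ⟨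
  2 * (27 ^ c * 1)         ≤⟨ m≤m+n _ _ ⟩
  _                        ∎
  where open ≤-Reasoning
-- For y ≤ -2 the bound 1 + y / 2 is at most 0, so the last summand alone suffices; this and
-- `tangent 1 (suc (suc w))` are of that kind. The remaining pair (1, 1) has y = -1 and is computed.
tangent 0 (suc w) = m≤n⇒m≤o+n _ (*-monoʳ-≤ (18 ^ suc w) (*-monoʳ-≤ 2 (s≤s z≤n)))
tangent 1 1 = toWitness {a? = _ ≤? _} _
tangent 1 (suc (suc w)) =
  m≤n⇒m≤o+n _ (*-monoʳ-≤ (18 ^ (3 + w)) (≤-trans (n≤1+n 3) (*-monoʳ-≤ 2 (s≤s (s≤s z≤n)))))
-- Two hits and one miss cancel in y, and `27 * 27 * 8 = 18 ^ 3`, so the case `(c , w)` only needs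
-- rescaling.
tangent (suc (suc c)) (suc w) = begin
  18 ^ (2 + c + suc w) * (4 + c)                     ≡⟨ cong (λ e → 18 ^ (2 + e) * (4 + c)) (+-suc c w) ⟩
  18 * (18 * (18 * x)) * (4 + c)                     ≡⟨ expand x c ⟩
  18 * 18 * 18 * (x * (2 + c)) + 18 * (18 * (18 * x)) * 2          ≤⟨ +-monoˡ-≤ _ (*-monoʳ-≤ (18 * 18 * 18) (tangent c w)) ⟩
  18 * 18 * 18 * (2 * (y * z) + x * (2 * w)) + 18 * (18 * (18 * x)) * 2
                                                     ≡⟨ collect x y z w ⟩
  2 * (27 * (27 * y) * (8 * z)) + 18 * (18 * (18 * x)) * (2 * suc w)
                                                     ≡⟨ cong (λ e → 2 * (27 * (27 * y) * (8 * z)) + 18 ^ (2 + e) * (2 * suc w)) (+-suc c w) ⟨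
  2 * (27 ^ (2 + c) * 8 ^ suc w) + 18 ^ (2 + c + suc w) * (2 * suc w) ∎
  where
  open ≤-Reasoning
  x = 18 ^ (c + w)
  y = 27 ^ c
  z = 8 ^ w
  expand : ∀ x c → 18 * (18 * (18 * x)) * (4 + c) ≡ 18 * 18 * 18 * (x * (2 + c)) + 18 * (18 * (18 * x)) * 2
  expand = solve-∀
  collect : ∀ x y z w → 18 * 18 * 18 * (2 * (y * z) + x * (2 * w)) + 18 * (18 * (18 * x)) * 2 ≡
                        2 * (27 * (27 * y) * (8 * z)) + 18 * (18 * (18 * x)) * (2 * (1 + w))
  collect = solve-∀

misses : ∀ {M} (g : Fin M → Bool) S →
  ∃[ w ] hits g S + w ≡ M × weight g S ≡ 27 ^ hits g S * 8 ^ w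
misses g []      = 0 , refl , refl
misses g (b ∷ S) with does (g zero Bool.≟ b) | misses (g ∘ suc) S
... | true  | w , sum , eq = w , cong suc sum , trans (cong (27 *_) eq) (sym (*-assoc 27 (27 ^ hits (g ∘ suc) S) (8 ^ w)))
... | false | w , sum , eq = suc w , trans (+-suc _ w) (cong suc sum) , trans (cong (8 *_) eq) (shuffle (27 ^ hits (g ∘ suc) S) (8 ^ w))
  where
  shuffle : ∀ x y → 8 * (x * y) ≡ x * (8 * y)
  shuffle = solve-∀

-- Adding twice the hits to both sides of `tangent` completes twice the misses to the constant
-- `2 * M`. The bound is then linear in the hits and can be averaged over the coins.
weight-tangent : ∀ {M} (g : Fin M → Bool) S →
  18 ^ M * 2 + 18 ^ M * (3 * hits g S) ≤ 2 * weight g S + 18 ^ M * (2 * M)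
weight-tangent g S with w , sum , eq ← misses g S = from-misses (hits g S) w sum eq
  where
  open ≤-Reasoning
  split : ∀ x c → x * 2 + x * (3 * c) ≡ x * (2 + c) + x * (2 * c)
  split = solve-∀
  merge : ∀ v x c w → 2 * v + x * (2 * w) + x * (2 * c) ≡ 2 * v + x * (2 * (c + w))
  merge = solve-∀
  from-misses : ∀ c w {M v} → c + w ≡ M → v ≡ 27 ^ c * 8 ^ w →
    18 ^ M * 2 + 18 ^ M * (3 * c) ≤ 2 * v + 18 ^ M * (2 * M)
  from-misses c w {v = v} refl refl = begin
    x * 2 + x * (3 * c)                     ≡⟨ split x c ⟩
    x * (2 + c) + x * (2 * c)               ≤⟨ +-monoˡ-≤ _ (tangent c w) ⟩
    2 * v + x * (2 * w) + x * (2 * c)       ≡⟨ merge v x c w ⟩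
    2 * v + x * (2 * (c + w))               ∎
    where x = 18 ^ (c + w)

-- Linearity of expectation. With `K` twice the number of coins, it says that the expected number of
-- hits is at least two thirds of `M`.
∑-hits : ∀ {Ω : Set} (ωs : List Ω) {M} (g : Ω → Fin M → Bool) S K →
         (∀ i → K ≤ 3 * ∑ ωs (λ ω → hit (g ω i) (lookup S i))) →
         M * K ≤ 3 * ∑ ωs (λ ω → hits (g ω) S)
∑-hits ωs g []      K K≤ = z≤n
∑-hits ωs {suc M} g (b ∷ S) K K≤ = begin
  K + M * K                     ≤⟨ +-mono-≤ (K≤ zero) (∑-hits ωs (λ ω → g ω ∘ suc) S K (K≤ ∘ suc)) ⟩
  3 * ∑ ωs h + 3 * ∑ ωs t       ≡⟨ *-distribˡ-+ 3 (∑ ωs h) _ ⟨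
  3 * (∑ ωs h + ∑ ωs t)         ≡⟨ cong (3 *_) (∑-+ ωs h t) ⟨
  _                             ∎
  where
  open ≤-Reasoning
  h t : _ → ℕ
  h ω = hit (g ω zero) b
  t ω = hits (g ω ∘ suc) S

^-distribʳ-* : ∀ e m n → (m * n) ^ e ≡ m ^ e * n ^ e
^-distribʳ-* zero    m n = refl
^-distribʳ-* (suc e) m n = trans (cong (m * n *_) (^-distribʳ-* e m n)) (interchange m n _ _)
  where
  interchange : ∀ a b c d → a * b * (c * d) ≡ a * c * (b * d)
  interchange = solve-∀

-- 25 is the least exponent e with `(36/35) ^ e ≥ 2`. If `M` exceeded `25 * s`, the excess factors
-- would make the opposite inequality strict.
ratio-bound : ∀ s M → 36 ^ M ≤ 2 ^ s * 35 ^ M → M ≤ 25 * s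
ratio-bound s M le with M ≤? 25 * s
... | yes p = p
... | no ¬p = contradiction le (<⇒≱ gap)
  where
  open ≤-Reasoning
  pow : ∀ s → 2 ^ s * 35 ^ (25 * s) ≤ 36 ^ (25 * s)
  pow s = begin
    2 ^ s * 35 ^ (25 * s)    ≡⟨ cong (2 ^ s *_) (^-*-assoc 35 25 s) ⟨
    2 ^ s * (35 ^ 25) ^ s    ≡⟨ ^-distribʳ-* s 2 (35 ^ 25) ⟨
    (2 * 35 ^ 25) ^ s        ≤⟨ ^-monoˡ-≤ s (toWitness {a? = 2 * 35 ^ 25 ≤? 36 ^ 25} _) ⟩
    (36 ^ 25) ^ s            ≡⟨ ^-*-assoc 36 25 s ⟩
    36 ^ (25 * s)            ∎
  r = M ∸ suc (25 * s)
  M≡ : 25 * s + suc r ≡ M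
  M≡ = trans (+-suc (25 * s) r) (m+[n∸m]≡n (≰⇒> ¬p))
  gap : 2 ^ s * 35 ^ M < 36 ^ M
  gap = begin-strict
    2 ^ s * 35 ^ M                          ≡⟨ cong (λ m → 2 ^ s * 35 ^ m) M≡ ⟨
    2 ^ s * 35 ^ (25 * s + suc r)           ≡⟨ cong (2 ^ s *_) (^-distribˡ-+-* 35 (25 * s) (suc r)) ⟩
    2 ^ s * (35 ^ (25 * s) * 35 ^ suc r)    ≡⟨ *-assoc (2 ^ s) _ _ ⟨
    2 ^ s * 35 ^ (25 * s) * 35 ^ suc r      ≤⟨ *-monoˡ-≤ (35 ^ suc r) (pow s) ⟩
    36 ^ (25 * s) * 35 ^ suc r              <⟨ *-monoʳ-< (36 ^ (25 * s)) {{m^n≢0 36 (25 * s)}} (^-monoˡ-< (suc r) ≤-refl) ⟩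
    36 ^ (25 * s) * 36 ^ suc r              ≡⟨ ^-distribˡ-+-* 36 (25 * s) (suc r) ⟨
    36 ^ (25 * s + suc r)                   ≡⟨ cong (36 ^_) M≡ ⟩
    36 ^ M                                  ∎

-- One-way communication with public coins: `ωs` lists the equally likely coins, seen by both `send`
-- and `guess`. The total of `W` over strings and coins is bounded above for fixed coins and below
-- for a fixed string.
index-bound : ∀ {Ω : Set} (ωs : List Ω) → 0 < length ωs → ∀ {s M}
  (send : Ω → Vec Bool M → Memory s) (guess : Ω → Memory s → Fin M → Bool) →
  (∀ S i → 2 * length ωs ≤ 3 * ∑ ωs (λ ω → hit (guess ω (send ω S) i) (lookup S i))) →
  M ≤ 25 * s
index-bound {Ω} ωs ω>0 {s} {M} send guess good =
  ratio-bound s M (*-cancelˡ-≤ L {{>-nonZero ω>0}} bound)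
  where
  open ≤-Reasoning
  L = length ωs
  V = allVecs bools M
  x = 18 ^ M

  W : Ω → Vec Bool M → ℕ
  W ω S = weight (guess ω (send ω S)) S

  H : Ω → Vec Bool M → ℕ
  H ω S = hits (guess ω (send ω S)) S

  per-coins : ∀ ω → ∑ V (W ω) ≤ 2 ^ s * 35 ^ M
  per-coins ω = begin
    -- Summing over all messages instead of the one sent frees the guess from its dependence on `S`,
    -- as `∑-weight` requires.
    ∑ V (W ω)                                    ≤⟨ ∑-mono V (λ S → ∈⇒≤∑ (λ μ → weight (guess ω μ) S) (∈-allVecs ∈-bools (send ω S))) ⟩
    ∑ V (λ S → ∑ B (λ μ → weight (guess ω μ) S)) ≡⟨ ∑-swap V B _ ⟩
    ∑ B (λ μ → ∑ V (weight (guess ω μ)))         ≤⟨ ∑-mono B (λ μ → ≤-reflexive (∑-weight (guess ω μ))) ⟩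
    ∑ B (λ _ → 35 ^ M)                           ≡⟨ ∑-const B _ ⟩
    length B * 35 ^ M                            ≡⟨ cong (_* 35 ^ M) (length-allVecs-bools s) ⟩
    2 ^ s * 35 ^ M                               ∎
    where B = allVecs bools s

  per-string : ∀ S → L * x ≤ ∑ ωs (λ ω → W ω S)
  -- The cancelled term is the constant of `weight-tangent` summed over the coins. Success
  -- probability 2/3 is exactly what lets the hits outweigh it.
  per-string S = *-cancelˡ-≤ 2 (+-cancelʳ-≤ (x * (M * (2 * L))) _ _ (begin
    2 * (L * x) + x * (M * (2 * L))                        ≤⟨ +-monoʳ-≤ (2 * (L * x)) (*-monoʳ-≤ x (∑-hits ωs (λ ω → guess ω (send ω S)) S (2 * L) (good S))) ⟩
    2 * (L * x) + x * (3 * ∑ ωs (λ ω → H ω S))             ≡⟨ cong₂ _+_ (trans (shuffle₁ L x) (sym (∑-const ωs _)))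
                                                               (trans (cong (x *_) (sym (∑-*ˡ ωs 3 _))) (sym (∑-*ˡ ωs x _))) ⟩
    ∑ ωs (λ _ → x * 2) + ∑ ωs (λ ω → x * (3 * H ω S))      ≡⟨ ∑-+ ωs _ _ ⟨
    ∑ ωs (λ ω → x * 2 + x * (3 * H ω S))                   ≤⟨ ∑-mono ωs (λ ω → weight-tangent (guess ω (send ω S)) S) ⟩
    ∑ ωs (λ ω → 2 * W ω S + x * (2 * M))                   ≡⟨ ∑-+ ωs _ _ ⟩
    ∑ ωs (λ ω → 2 * W ω S) + ∑ ωs (λ _ → x * (2 * M))      ≡⟨ cong₂ _+_ (∑-*ˡ ωs 2 _) (trans (∑-const ωs _) (shuffle₂ L x M)) ⟩
    2 * ∑ ωs (λ ω → W ω S) + x * (M * (2 * L))             ∎))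
    where
    shuffle₁ : ∀ l y → 2 * (l * y) ≡ l * (y * 2)
    shuffle₁ = solve-∀
    shuffle₂ : ∀ l y m → l * (y * (2 * m)) ≡ y * (m * (2 * l))
    shuffle₂ = solve-∀

  bound : L * 36 ^ M ≤ L * (2 ^ s * 35 ^ M)
  bound = begin
    -- `36 = 2 * 18`: there are `2 ^ M` strings, and `18 ^ M` is the cleared denominator of
    -- `weight`.
    L * 36 ^ M                          ≡⟨ cong (L *_) (^-distribʳ-* M 2 18) ⟩
    L * (2 ^ M * x)                     ≡⟨ shuffle L (2 ^ M) x ⟩
    2 ^ M * (L * x)                     ≡⟨ cong (_* (L * x)) (length-allVecs-bools M) ⟨
    length V * (L * x)                  ≡⟨ ∑-const V _ ⟨
    ∑ V (λ _ → L * x)                   ≤⟨ ∑-mono V per-string ⟩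
    ∑ V (λ S → ∑ ωs (λ ω → W ω S))      ≡⟨ ∑-swap V ωs _ ⟩
    ∑ ωs (λ ω → ∑ V (W ω))              ≤⟨ ∑-mono ωs per-coins ⟩
    ∑ ωs (λ _ → 2 ^ s * 35 ^ M)         ≡⟨ ∑-const ωs _ ⟩
    L * (2 ^ s * 35 ^ M)                ∎
    where
    shuffle : ∀ l y z → l * (y * z) ≡ y * (l * z)
    shuffle = solve-∀

-- Translations modulo q

toℕ-mod : ∀ m q .{{_ : NonZero q}} → toℕ (m mod q) ≡ m % q
toℕ-mod m q = Fin.toℕ-fromℕ< (m%n<n m q)

[m+n%d]%d≡[m+n]%d : ∀ m n d .{{_ : NonZero d}} → (m + n % d) % d ≡ (m + n) % d
[m+n%d]%d≡[m+n]%d m n d = begin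
  (m + n % d) % d          ≡⟨ %-distribˡ-+ m (n % d) d ⟩
  (m % d + n % d % d) % d  ≡⟨ cong (λ e → (m % d + e) % d) (m%n%n≡m%n n d) ⟩
  (m % d + n % d) % d      ≡⟨ %-distribˡ-+ m n d ⟨
  (m + n) % d              ∎
  where open ≡-Reasoning

module _ {p : ℕ} where

  private
    q = suc p

  infixl 6 _⊖_
  _⊖_ : Fin q → Fin q → Fin q
  t ⊖ a = (toℕ t + (q ∸ toℕ a)) mod q

  toℕ-⊕⊖ : ∀ (b t a : Fin q) → toℕ (b ⊕ (t ⊖ a)) ≡
           (toℕ b + (toℕ t + (q ∸ toℕ a))) % q
  toℕ-⊕⊖ b t a = begin
    toℕ (b ⊕ (t ⊖ a))                              ≡⟨ toℕ-mod (toℕ b + toℕ (t ⊖ a)) q ⟩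
    (toℕ b + toℕ (t ⊖ a)) % q                      ≡⟨ cong (λ e → (toℕ b + e) % q) (toℕ-mod (toℕ t + (q ∸ toℕ a)) q) ⟩
    (toℕ b + (toℕ t + (q ∸ toℕ a)) % q) % q        ≡⟨ [m+n%d]%d≡[m+n]%d (toℕ b) _ q ⟩
    (toℕ b + (toℕ t + (q ∸ toℕ a))) % q            ∎
    where
    open ≡-Reasoning

  ⊕-⊖-cancel : ∀ a t → a ⊕ (t ⊖ a) ≡ t
  ⊕-⊖-cancel a t = Fin.toℕ-injective (begin
    toℕ (a ⊕ (t ⊖ a))                     ≡⟨ toℕ-⊕⊖ a t a ⟩
    (toℕ a + (toℕ t + (q ∸ toℕ a))) % q   ≡⟨ cong (_% q) (swap (toℕ a) (toℕ t) _) ⟩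
    (toℕ t + (toℕ a + (q ∸ toℕ a))) % q   ≡⟨ cong (λ e → (toℕ t + e) % q) (m+[n∸m]≡n (<⇒≤ (Fin.toℕ<n a))) ⟩
    (toℕ t + q) % q                       ≡⟨ [m+n]%n≡m%n (toℕ t) q ⟩
    toℕ t % q                             ≡⟨ m<n⇒m%n≡m (Fin.toℕ<n t) ⟩
    toℕ t                                 ∎)
    where
    open ≡-Reasoning
    swap : ∀ x y z → x + (y + z) ≡ y + (x + z)
    swap = solve-∀

  translate : (a b t : Fin q) → Fin q
  translate a b t = b ⊕ (t ⊖ a)

  toℕ-fold-translate : ∀ a b s m → toℕ (fold (b ⊕ s) (translate a b) m) ≡
    (toℕ b + toℕ s + m * (toℕ b + (q ∸ toℕ a))) % q
  toℕ-fold-translate a b s zero    = trans (toℕ-mod (toℕ b + toℕ s) q)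
    (cong (_% q) (sym (+-identityʳ (toℕ b + toℕ s))))
  toℕ-fold-translate a b s (suc m) = begin
    toℕ (b ⊕ (fold (b ⊕ s) (translate a b) m ⊖ a))    ≡⟨ toℕ-⊕⊖ b _ a ⟩
    (toℕ b + (toℕ (fold (b ⊕ s) (translate a b) m) + e)) % q
                                                      ≡⟨ cong (λ z → (toℕ b + (z + e)) % q) (toℕ-fold-translate a b s m) ⟩
    (toℕ b + (x % q + e)) % q                         ≡⟨ cong (_% q) (regroup (toℕ b) (x % q) e) ⟩
    (toℕ b + e + x % q) % q                           ≡⟨ [m+n%d]%d≡[m+n]%d (toℕ b + e) x q ⟩
    (toℕ b + e + x) % q                               ≡⟨ cong (_% q) (next (toℕ b) (toℕ s) m e) ⟩
    (toℕ b + toℕ s + suc m * (toℕ b + e)) % q         ∎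
    where
    open ≡-Reasoning
    e = q ∸ toℕ a
    x = toℕ b + toℕ s + m * (toℕ b + e)
    regroup : ∀ b x e → b + (x + e) ≡ b + e + x
    regroup = solve-∀
    next : ∀ b s m e → b + e + (b + s + m * (b + e)) ≡ b + s + (1 + m) * (b + e)
    next = solve-∀

  -- translate a b adds b − a, so q − 1 applications subtract it.
  fold-translate-pred : ∀ a b s → fold (b ⊕ s) (translate a b) p ≡ a ⊕ s
  fold-translate-pred a b s = Fin.toℕ-injective (begin
    toℕ (fold (b ⊕ s) (translate a b) p)   ≡⟨ toℕ-fold-translate a b s p ⟩
    -- The added `q`, split as `toℕ a + e`, supplies the wanted `a` and leaves `q` copies of
    -- `b + e`, which vanish modulo `q`.
    x % q                                         ≡⟨ [m+n]%n≡m%n x q ⟨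
    (x + q) % q                                   ≡⟨ cong (_% q) x+q ⟩
    (toℕ a + toℕ s + (toℕ b + e) * q) % q         ≡⟨ [m+kn]%n≡m%n (toℕ a + toℕ s) (toℕ b + e) q ⟩
    (toℕ a + toℕ s) % q                           ≡⟨ toℕ-mod (toℕ a + toℕ s) q ⟨
    toℕ (a ⊕ s)                                   ∎)
    where
    open ≡-Reasoning
    e = q ∸ toℕ a
    x = toℕ b + toℕ s + p * (toℕ b + e)
    rearrange : ∀ p a b s e → b + s + p * (b + e) + (a + e) ≡ a + s + (b + e) * (1 + p)
    rearrange = solve-∀
    x+q : x + q ≡ toℕ a + toℕ s + (toℕ b + e) * q
    x+q = begin
      x + q                                     ≡⟨ cong (x +_) (m+[n∸m]≡n (<⇒≤ (Fin.toℕ<n a))) ⟨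
      x + (toℕ a + e)                           ≡⟨ rearrange p (toℕ a) (toℕ b) (toℕ s) e ⟩
      toℕ a + toℕ s + (toℕ b + e) * q           ∎

zipWith-map-map : ∀ {A B C D : Set} (f : B → C → D) (g : A → B) (h : A → C) {m} (xs : Vec A m) →
                  Vec.zipWith f (Vec.map g xs) (Vec.map h xs) ≡ Vec.map (λ x → f (g x) (h x)) xs
zipWith-map-map f g h []       = refl
zipWith-map-map f g h (x ∷ xs) = cong (_ ∷_) (zipWith-map-map f g h xs)

-- The lower bound

module _ {p k : ℕ} {Γ : Language (suc p) k} {n : ℕ} where
  open CSP Γ n

  private
    q = suc p

  Target : Set
  Target = Fin (size Γ) × Vec (Fin q) k × Vec (Fin n) k

  allTargets : List Target
  allTargets = cartesianProduct (allFin (size Γ))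
    (cartesianProduct (allVecs (allFin q) k) (allVecs (allFin n) k))

  attained? : Decidable {A = Target} (λ (r , t , _) → relation Γ r t ≡ true)
  attained? (r , t , _) = relation Γ r t Bool.≟ true

  targets : List Target
  targets = filter attained? allTargets

  ∈-targets : ∀ r t is → relation Γ r t ≡ true → (r , t , is) ∈ targets
  ∈-targets r t is rt = ∈-filter⁺ attained? (∈-cartesianProduct⁺ (∈-allFin r)
    (∈-cartesianProduct⁺ (∈-allVecs ∈-allFin t) (∈-allVecs ∈-allFin is))) rt

  pin : Assignment → Target → Constraint
  pin a (r , t , is) = r , Vec.zipWith (λ i u → i , u ⊖ lookup a i) is t

  -- All constraints satisfied by a.  They are indexed by the value they take at
  -- a, which makes their number independent of a.
  pins : Assignment → Instance
  pins a = map (pin a) targets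

  values : Assignment → Vec (Fin n × Fin q) k → Vec (Fin q) k
  values a = Vec.map (λ (i , s) → lookup a i ⊕ s)

  values-pin : ∀ a b {m} (is : Vec (Fin n) m) (t : Vec (Fin q) m) →
    Vec.map (λ (i , s) → lookup b i ⊕ s) (Vec.zipWith (λ i u → i , u ⊖ lookup a i) is t) ≡
    Vec.zipWith (λ i → translate (lookup a i) (lookup b i)) is t
  values-pin a b []       []      = refl
  values-pin a b (i ∷ is) (u ∷ t) = cong (_ ∷_) (values-pin a b is t)

  zipWith-translate-self : ∀ a {m} (is : Vec (Fin n) m) (t : Vec (Fin q) m) →
    Vec.zipWith (λ i → translate (lookup a i) (lookup a i)) is t ≡ t
  zipWith-translate-self a []       []      = refl
  zipWith-translate-self a (i ∷ is) (u ∷ t) =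
    cong₂ _∷_ (⊕-⊖-cancel (lookup a i) u) (zipWith-translate-self a is t)

  relation-pin : ∀ a r t is → relation Γ r (values a (proj₂ (pin a (r , t , is)))) ≡ relation Γ r t
  relation-pin a r t is =
    cong (relation Γ r) (trans (values-pin a a is t) (zipWith-translate-self a is t))

  sat-pins : ∀ a → Sat (pins a) a
  sat-pins a = All.map⁺ (All.map (λ {(r , t , is)} rt → trans (relation-pin a r t is) rt)
                                 (All.all-filter attained? allTargets))

  -- If b satisfies pins a, each relation is closed under the translation by
  -- b − a restricted to any k-tuple of variables.  That translation has finite
  -- order, so the relation is closed under its inverse as well.
  pins-reflect : ∀ a b → Sat (pins a) b → ∀ C → Satisfies b C → Satisfies a C
  pins-reflect a b sat (r , vs) sat-C =
    trans (cong (relation Γ r) (sym (Vec.map-cong (λ (i , s) → fold-translate-pred (lookup a i) (lookup b i) s) vs)))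
          (closed p)
    where
    is = Vec.map proj₁ vs
    iterate-at : ℕ → Fin n × Fin q → Fin q
    iterate-at m (i , s) = fold (lookup b i ⊕ s) (translate (lookup a i) (lookup b i)) m
    closed : ∀ m → relation Γ r (Vec.map (iterate-at m) vs) ≡ true
    closed zero    = sat-C
    -- The current iterate lies in the relation, hence is the target of some constraint in `pins a`;
    -- that constraint takes the next iterate as its value at `b`.
    closed (suc m) = trans
      (cong (relation Γ r) (sym (trans (values-pin a b is _)
        (zipWith-map-map (λ i → translate (lookup a i) (lookup b i)) proj₁ (iterate-at m) vs))))
      (All.lookup (All.map⁻ sat) (∈-targets r _ is (closed m)))

  module _ {s : ℕ} (A : RandomizedAlgorithm s) where
    open RandomizedAlgorithm A

    -- Draws form a list here, not a vector indexed by the stream, so that they can be cut where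
    -- Alice hands over to Bob. The clauses for exhausted draws are defaults; the streams below
    -- never reach them.
    pastAfter : ℕ → List Draw → List Draw → List Draw
    pastAfter zero    past ωs       = past
    pastAfter (suc m) past []       = past
    pastAfter (suc m) past (ω ∷ ωs) = pastAfter m (ω ∷ past) ωs

    memoryAfter : List Draw → Memory s → Instance → List Draw → Memory s
    memoryAfter past μ []      ωs       = μ
    memoryAfter past μ (C ∷ I) []       = μ
    memoryAfter past μ (C ∷ I) (ω ∷ ωs) = memoryAfter (ω ∷ past) (step (ω ∷ past) μ C) I ωs

    memoryAfter-++ : ∀ past μ I J ωs → memoryAfter past μ (I ++ J) ωs ≡
      memoryAfter (pastAfter (length I) past ωs) (memoryAfter past μ I ωs) J (drop (length I) ωs)
    memoryAfter-++ past μ []      J       ωs       = refl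
    memoryAfter-++ past μ (C ∷ I) []      []       = refl
    memoryAfter-++ past μ (C ∷ I) (_ ∷ _) []       = refl
    memoryAfter-++ past μ (C ∷ I) J       (ω ∷ ωs) = memoryAfter-++ (ω ∷ past) _ I J ωs

    runFrom≡ : ∀ past μ I ωs → runFrom past μ I ωs ≡
      output (pastAfter (length I) past (toList ωs)) (memoryAfter past μ I (toList ωs))
    runFrom≡ past μ []      []       = refl
    runFrom≡ past μ (C ∷ I) (ω ∷ ωs) = runFrom≡ (ω ∷ past) _ I ωs

    -- The number of draws is a parameter separate from `I`, so that different streams of equal
    -- length share one coin space.
    answer : ∀ {T} → Instance → Vec Draw (suc T) → Bool
    answer {T} I (ω ∷ ωs) =
      output (pastAfter T [ ω ] (toList ωs)) (memoryAfter [ ω ] (start [ ω ]) I (toList ωs))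

    answer-succeeds : Succeeds → ∀ {T} I → length I ≡ T →
      let Ω = allVecs (allFin (suc d)) (suc T) in
      2 * length Ω ≤ 3 * ∑ Ω (λ ω → hit (answer I ω) (does (satisfiable? I)))
    answer-succeeds succeeds I refl = begin
      2 * length (draws I)                  ≤⟨ succeeds I ⟩
      3 * length (correctDraws I)           ≡⟨ cong (3 *_) (length-filter≡∑ _ (draws I)) ⟩
      3 * ∑ (draws I) (λ ω → hit (run I ω) (does (satisfiable? I)))
                                            ≤⟨ *-monoʳ-≤ 3 (∑-mono (draws I) λ { (ω ∷ ωs) → ≤-reflexive (cong (λ b → hit b (does (satisfiable? I))) (runFrom≡ [ ω ] _ I ωs)) }) ⟩
      _                                     ∎
      where open ≤-Reasoning

    -- INDEX reduces to CSP(Γ): Alice streams code j Sⱼ for every j, and Bob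
    -- appends pins (a i); the result is satisfiable iff Sᵢ is true.
    index-reduction : Succeeds → ∀ {M} (code : Fin M → Bool → Constraint) (a : Fin M → Assignment) →
      (∀ i j → Satisfies (a i) (code j true)) →
      (∀ i j → i ≢ j → Satisfies (a i) (code j false)) →
      (∀ i → ¬ Satisfies (a i) (code i false)) →
      M ≤ 25 * s
    index-reduction succeeds {M} code a sat-true sat-false unsat = index-bound Ω
      (∈-length (∈-allVecs ∈-allFin (Vec.replicate (suc T) zero))) send guess λ S i →
        ≤-trans (answer-succeeds succeeds (stream S i) (length-stream S i))
          (*-monoʳ-≤ 3 (∑-mono Ω λ ω →
            ≤-reflexive (cong₂ hit (answer≡guess S i ω) (satisfiable-stream S i))))
      where
      alice : Vec Bool M → Instance
      alice S = map (λ j → code j (lookup S j)) (allFin M)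

      stream : Vec Bool M → Fin M → Instance
      stream S i = alice S ++ pins (a i)

      -- Independent of `S` and `i`: each bit is streamed as exactly one constraint, and every
      -- `pins (a i)` has as many members as `targets`.
      T = M + length targets
      Ω = allVecs (allFin (suc d)) (suc T)

      length-alice : ∀ S → length (alice S) ≡ M
      length-alice S = trans (length-map _ (allFin M)) (length-tabulate _)

      length-stream : ∀ S i → length (stream S i) ≡ T
      length-stream S i = trans (length-++ (alice S))
        (cong₂ _+_ (length-alice S) (length-map (pin (a i)) targets))

      send : Vec Draw (suc T) → Vec Bool M → Memory s
      send (ω ∷ ωs) S = memoryAfter [ ω ] (start [ ω ]) (alice S) (toList ωs)

      guess : Vec Draw (suc T) → Memory s → Fin M → Bool
      guess (ω ∷ ωs) μ i = output (pastAfter T [ ω ] (toList ωs))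
        (memoryAfter (pastAfter M [ ω ] (toList ωs)) μ (pins (a i)) (drop M (toList ωs)))

      answer≡guess : ∀ S i ω → answer (stream S i) ω ≡ guess ω (send ω S) i
      answer≡guess S i (ω ∷ ωs) = cong (output _) (trans
        (memoryAfter-++ [ ω ] _ (alice S) (pins (a i)) (toList ωs))
        (cong (λ l → memoryAfter (pastAfter l [ ω ] (toList ωs)) (send (ω ∷ ωs) S) (pins (a i)) (drop l (toList ωs)))
              (length-alice S)))

      satisfiable-stream : ∀ S i → does (satisfiable? (stream S i)) ≡ lookup S i
      satisfiable-stream S i with lookup S i in Sᵢ
      ... | true  = dec-true (satisfiable? (stream S i))
        (a i , All.++⁺ (All.map⁺ (All.tabulate λ {j} _ → sat-code j)) (sat-pins (a i)))
        where
        sat-code : ∀ j → Satisfies (a i) (code j (lookup S j))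
        sat-code j with lookup S j in Sⱼ
        ... | true  = sat-true i j
        ... | false = sat-false i j λ { refl → contradiction (trans (sym Sᵢ) Sⱼ) λ () }
      ... | false = dec-false (satisfiable? (stream S i)) λ (b , sat) →
        unsat i (pins-reflect (a i) b (All.++⁻ʳ (alice S) sat) (code i false)
          (subst (λ c → Satisfies b (code i c)) Sᵢ (All.lookup (All.map⁻ (All.++⁻ˡ (alice S) sat)) (∈-allFin i))))

-- From non-redundant instances to INDEX

lookup-injective : ∀ {A : Set} {xs : List A} → Unique xs → ∀ i j →
                   List.lookup xs i ≡ List.lookup xs j → i ≡ j
lookup-injective (_  ∷ _)   zero    zero    _  = refl
lookup-injective (x∉ ∷ _)   zero    (suc j) eq = contradiction eq (All.lookup x∉ (∈-lookup j))
lookup-injective (x∉ ∷ _)   (suc i) zero    eq = contradiction (sym eq) (All.lookup x∉ (∈-lookup i))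
lookup-injective (_  ∷ xs!) (suc i) (suc j) eq = cong suc (lookup-injective xs! i j eq)

module _ {q k : ℕ} {Γ : Language q k} {n : ℕ} where
  open CSP Γ n

  satisfies? : ∀ a C → Dec (Satisfies a C)
  satisfies? a (r , vs) = _ Bool.≟ true

  sat-∖ : ∀ I C a {D} → Sat (I ∖ C) a → D ∈ I → D ≢ C → Satisfies a D
  sat-∖ I C a sat D∈I D≢C = All.lookup sat (∈-filter⁺ (λ D → ¬? (D ≟ C)) D∈I D≢C)

  ∖-redundant : ∀ {I C} → (∀ a → Sat (I ∖ C) a → Satisfies a C) → Redundant I C
  ∖-redundant {I} {C} implied a = mk⇔
    (λ sat → All.tabulate λ {D} D∈I → restore sat D∈I (D ≟ C))
    (All.filter⁺ (λ D → ¬? (D ≟ C)))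
    where
    restore : Sat (I ∖ C) a → ∀ {D} → D ∈ I → Dec (D ≡ C) → Satisfies a D
    restore sat D∈I (yes refl) = implied a sat
    restore sat D∈I (no D≢C)   = sat-∖ I C a sat D∈I D≢C

  -- There are finitely many assignments, so a search turns the negated universal statement into an
  -- actual witness.
  separating : ∀ {I C} → ¬ Redundant I C → ∃[ a ] Sat (I ∖ C) a × ¬ Satisfies a C
  separating {I} {C} ¬red with enum-any? ∈-assignments (λ a → sat? (I ∖ C) a ×-dec ¬? (satisfies? a C))
  ... | yes found = found
  ... | no  none  = contradiction
    (∖-redundant λ a sat → decidable-stable (satisfies? a C) λ ¬sat → none (a , sat , ¬sat)) ¬red

module _ {p k : ℕ} {Γ : Language (suc p) k} {n : ℕ} {s : ℕ}
         (A : CSP.RandomizedAlgorithm Γ n s) (succeeds : CSP.RandomizedAlgorithm.Succeeds A) where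
  open CSP Γ n

  -- `C₀` is the filler streamed for a true bit. It differs from every member of `I`, so each
  -- separating assignment satisfies it, and its repetition is harmless.
  nonRedundant⇒index : ∀ {C₀ I} → Unique (C₀ ∷ I) → NonRedundant (C₀ ∷ I) → length I ≤ 25 * s
  nonRedundant⇒index {C₀} {I} (C₀∉I ∷ I!) (_ ∷ nr) = index-reduction A succeeds
    (λ { j true → C₀ ; j false → List.lookup I j })
    (λ i → proj₁ (sep i))
    (λ i j → sat-∖ {Γ = Γ} (C₀ ∷ I) _ (proj₁ (sep i)) (proj₁ (proj₂ (sep i))) (here refl) (All.lookup C₀∉I (∈-lookup i)))
    (λ i j i≢j → sat-∖ {Γ = Γ} (C₀ ∷ I) _ (proj₁ (sep i)) (proj₁ (proj₂ (sep i))) (there (∈-lookup {xs = I} j))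
      λ eq → i≢j (sym (lookup-injective I! j i eq)))
    (λ i → proj₂ (proj₂ (sep i)))
    where
    sep : ∀ i → ∃[ a ] Sat ((C₀ ∷ I) ∖ List.lookup I i) a × ¬ Satisfies a (List.lookup I i)
    sep i = separating {Γ = Γ} (All.lookup nr (∈-lookup i))

module _ {p k : ℕ} {Γ : Language (suc p) k} (Γ-nontrivial : NonTrivial Γ) {n : ℕ} {s : ℕ}
         (A : CSP.RandomizedAlgorithm Γ (suc n) s) (succeeds : CSP.RandomizedAlgorithm.Succeeds A) where
  open CSP Γ (suc n)

  -- Padding with C₀ costs one bit of the index string, so a language that only
  -- has one-element non-redundant instances needs a separate one-bit instance.
  positive-space : 1 ≤ 25 * s
  positive-space = index-reduction A succeeds {1}
    (λ { _ true → pin {Γ = Γ} a (r , t₁ , is) ; _ false → pin {Γ = Γ} a (r , t₀ , is) })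
    (λ _ → a)
    (λ _ _ → trans (relation-pin {Γ = Γ} a r t₁ is) t₁∈r)
    (λ { zero zero i≢i → contradiction refl i≢i })
    (λ _ sat → contradiction (trans (sym sat) (trans (relation-pin {Γ = Γ} a r t₀ is) t₀∉r)) λ ())
    where
    a : Assignment
    a = Vec.replicate (suc n) zero
    -- Constraints may repeat a variable, so a single one suffices; this is why the number of
    -- variables is taken to be positive.
    is : Vec (Fin (suc n)) k
    is = Vec.replicate k zero
    r = proj₁ (proj₂ Γ-nontrivial)
    t₀ = proj₁ (proj₂ (proj₂ Γ-nontrivial))
    t₀∉r = proj₂ (proj₂ (proj₂ Γ-nontrivial))
    t₁ = proj₁ (proj₁ Γ-nontrivial r)
    t₁∈r = proj₂ (proj₁ Γ-nontrivial r)

  -- 26 is 25 for the constraints serving as index bits plus 1 for the filler, which is paid for by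
  -- `1 ≤ s`.
  NRD≤26*space : NRD ≤ 26 * s
  NRD≤26*space with proj₁ NRD-isMaximum
  ... | []     , _      , _  , len = subst (_≤ 26 * s) len z≤n
  ... | C ∷ I , unique , nr , len = subst (_≤ 26 * s) len
    (+-mono-≤ (s>0 s positive-space) (nonRedundant⇒index A succeeds unique nr))
    where
    s>0 : ∀ s → 1 ≤ 25 * s → 1 ≤ s
    s>0 (suc s) _ = s≤s z≤n

-- The streaming algorithm

module _ {A : Set} where

  -- The addresses of b bits cut xs into 2 ^ b consecutive blocks; if
  -- length xs ≤ 2 ^ b then each of them has at most one element.
  block : ∀ {b} → List A → Vec Bool b → List A
  block         xs []          = xs
  block {suc b} xs (false ∷ v) = block (take (2 ^ b) xs) v
  block {suc b} xs (true  ∷ v) = block (drop (2 ^ b) xs) v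

  length-drop-half : ∀ b {xs : List A} {m} → length xs ≤ m + 2 ^ suc b → length (drop (2 ^ b) xs) ≤ m + 2 ^ b
  length-drop-half b {xs} {m} len = begin
    length (drop (2 ^ b) xs)             ≡⟨ length-drop (2 ^ b) xs ⟩
    length xs ∸ 2 ^ b                    ≤⟨ ∸-monoˡ-≤ (2 ^ b) len ⟩
    m + (2 ^ b + (2 ^ b + 0)) ∸ 2 ^ b    ≡⟨ cong (_∸ 2 ^ b) (regroup m (2 ^ b)) ⟩
    m + 2 ^ b + 2 ^ b ∸ 2 ^ b            ≡⟨ m+n∸n≡m (m + 2 ^ b) (2 ^ b) ⟩
    m + 2 ^ b                            ∎
    where
    open ≤-Reasoning
    regroup : ∀ m x → m + (x + (x + 0)) ≡ m + x + x
    regroup = solve-∀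

  block-singleton : ∀ b {xs : List A} {x} → length xs ≤ 2 ^ b → x ∈ xs → ∃[ v ] block {b} xs v ≡ [ x ]
  block-singleton zero    {y ∷ []} len (here refl) = [] , refl
  block-singleton zero    {_ ∷ _ ∷ _} (s≤s ()) _
  block-singleton (suc b) {xs} len x∈
    with ∈-++⁻ (take (2 ^ b) xs) (subst (_ ∈_) (sym (take++drop≡id (2 ^ b) xs)) x∈)
  ... | inj₁ x∈take =
    let v , eq = block-singleton b (≤-trans (≤-reflexive (length-take (2 ^ b) xs)) (m⊓n≤m _ _)) x∈take
    in false ∷ v , eq
  ... | inj₂ x∈drop =
    let v , eq = block-singleton b (length-drop-half b {m = 0} len) x∈drop in true ∷ v , eq

  -- Strictness leaves the last, all-true address without an element.
  block-empty : ∀ b {xs : List A} → length xs < 2 ^ b → ∃[ v ] block {b} xs v ≡ []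
  block-empty zero    {[]} len = [] , refl
  block-empty zero    {_ ∷ _} (s≤s ())
  block-empty (suc b) {xs} len =
    let v , eq = block-empty b (half (≤-trans len (≤-reflexive (double (2 ^ b))))) in true ∷ v , eq
    where
    double : ∀ x → x + (x + 0) ≡ x + x
    double = solve-∀
    half : length xs < 2 ^ b + 2 ^ b → length (drop (2 ^ b) xs) < 2 ^ b
    half lt = subst (_< 2 ^ b) (sym (length-drop (2 ^ b) xs))
      (m<n+o⇒m∸n<o (length xs) (2 ^ b) {{m^n≢0 2 b}} lt)

  blocks : ∀ {b} → List A → ∀ N → Vec Bool (N * b) → List A
  blocks     xs zero    v = []
  blocks {b} xs (suc N) v = block xs (Vec.take b v) ++ blocks xs N (Vec.drop b v)

  blocks-++ : ∀ {b} xs N (u : Vec Bool b) v → blocks xs (suc N) (u Vec.++ v) ≡ block xs u ++ blocks xs N v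
  blocks-++ {b} xs N u v = cong₂ (λ u v → block xs u ++ blocks xs N v)
    (proj₁ take,drop) (proj₂ take,drop)
    where take,drop = Vec.++-injective (Vec.take b (u Vec.++ v)) u (Vec.take++drop≡id b (u Vec.++ v))

  -- Slots left over hold an address of an empty block, so shorter lists fit the same fixed width.
  blocks-surjective : ∀ {b xs} → length xs < 2 ^ b → (∀ x → x ∈ xs) →
    ∀ N ys → length ys ≤ N → ∃[ v ] blocks {b} xs N v ≡ ys
  blocks-surjective len enum zero    []       _ = [] , refl
  blocks-surjective {b} {xs} len enum (suc N) []  _ =
    let u , u≡ = block-empty b len
        v , v≡ = blocks-surjective len enum N [] z≤n
    in u Vec.++ v , trans (blocks-++ xs N u v) (cong₂ _++_ u≡ v≡)
  blocks-surjective {b} {xs} len enum (suc N) (y ∷ ys) (s≤s ys≤) =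
    let u , u≡ = block-singleton b (<⇒≤ len) (enum y)
        v , v≡ = blocks-surjective len enum N ys ys≤
    in u Vec.++ v , trans (blocks-++ xs N u v) (cong₂ _++_ u≡ v≡)

-- Counting constraints in bits

length-cartesianProductWith : ∀ {A B C : Set} (f : A → B → C) xs ys →
  length (cartesianProductWith f xs ys) ≡ length xs * length ys
length-cartesianProductWith f []       ys = refl
length-cartesianProductWith f (x ∷ xs) ys = trans (length-++ (map (f x) ys))
  (cong₂ _+_ (length-map (f x) ys) (length-cartesianProductWith f xs ys))

length-allVecs : ∀ {A : Set} (xs : List A) m → length (allVecs xs m) ≡ length xs ^ m
length-allVecs xs zero    = refl
length-allVecs xs (suc m) = trans (length-cartesianProductWith _∷_ xs _)
  (cong (length xs *_) (length-allVecs xs m))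

n≤2^⌈log2⌉n : ∀ n rs → n ≤ 2 ^ ⌈log2⌉ n rs
n≤2^⌈log2⌉n 0             _        = z≤n
n≤2^⌈log2⌉n 1             _        = s≤s z≤n
n≤2^⌈log2⌉n (suc (suc n)) (acc rs) = begin
  2 + n                               ≡⟨ ⌊n/2⌋+⌈n/2⌉≡n (2 + n) ⟨
  ⌊ 2 + n /2⌋ + ⌈ 2 + n /2⌉           ≤⟨ +-monoˡ-≤ _ (⌊n/2⌋≤⌈n/2⌉ (2 + n)) ⟩
  ⌈ 2 + n /2⌉ + ⌈ 2 + n /2⌉           ≡⟨ cong (⌈ 2 + n /2⌉ +_) (+-identityʳ _) ⟨
  2 * ⌈ 2 + n /2⌉                     ≤⟨ *-monoʳ-≤ 2 (n≤2^⌈log2⌉n (suc ⌈ n /2⌉) _) ⟩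
  2 ^ ⌈log2⌉ (2 + n) (acc rs)         ∎
  where open ≤-Reasoning

n≤2^⌈log₂n⌉ : ∀ n → n ≤ 2 ^ ⌈log₂ n ⌉
n≤2^⌈log₂n⌉ n = n≤2^⌈log2⌉n n (<-wellFounded n)

n<2^n : ∀ n → n < 2 ^ n
n<2^n zero    = s≤s z≤n
n<2^n (suc n) = +-mono-≤ (m^n>0 2 n) (≤-trans (n<2^n n) (m≤m+n _ 0))

module _ {q k : ℕ} (Γ : Language q k) (n : ℕ) where
  open CSP Γ n

  allConstraints : List Constraint
  allConstraints = cartesianProduct (allFin (size Γ))
    (allVecs (cartesianProduct (allFin n) (allFin q)) k)

  ∈-allConstraints : ∀ C → C ∈ allConstraints
  ∈-allConstraints (r , vs) = ∈-cartesianProduct⁺ (∈-allFin r)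
    (∈-allVecs (λ (i , s) → ∈-cartesianProduct⁺ (∈-allFin i) (∈-allFin s)) vs)

  length-allConstraints : length allConstraints ≡ size Γ * (n * q) ^ k
  length-allConstraints = trans (length-cartesianProductWith _,_ (allFin (size Γ)) _)
    (cong₂ _*_ (length-tabulate {n = size Γ} _)
      (trans (length-allVecs _ k) (cong (_^ k)
        (trans (length-cartesianProductWith _,_ (allFin n) (allFin q))
          (cong₂ _*_ (length-tabulate {n = n} _) (length-tabulate {n = q} _))))))

  -- Only the variables need a tight logarithm; the crude `size Γ` and `q` bits for the relation and
  -- each shift are constants. The count below is strict because `block-empty` needs a spare
  -- address.
  constraintBits : ℕ
  constraintBits = size Γ + (⌈log₂ n ⌉ + q) * k

  length-allConstraints< : length allConstraints < 2 ^ constraintBits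
  length-allConstraints< = begin-strict
    length allConstraints               ≡⟨ length-allConstraints ⟩
    size Γ * (n * q) ^ k                ≤⟨ *-monoʳ-≤ (size Γ) (^-monoˡ-≤ k (*-mono-≤ (n≤2^⌈log₂n⌉ n) (<⇒≤ (n<2^n q)))) ⟩
    size Γ * (2 ^ L * 2 ^ q) ^ k        ≡⟨ cong (λ e → size Γ * e ^ k) (^-distribˡ-+-* 2 L q) ⟨
    size Γ * (2 ^ (L + q)) ^ k          ≡⟨ cong (size Γ *_) (^-*-assoc 2 (L + q) k) ⟩
    size Γ * 2 ^ ((L + q) * k)          <⟨ *-monoˡ-< _ {{m^n≢0 2 ((L + q) * k)}} (n<2^n (size Γ)) ⟩
    2 ^ size Γ * 2 ^ ((L + q) * k)      ≡⟨ ^-distribˡ-+-* 2 (size Γ) _ ⟨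
    2 ^ constraintBits                  ∎
    where
    open ≤-Reasoning
    L = ⌈log₂ n ⌉

  redundant? : ∀ I C → Dec (Redundant I C)
  redundant? I C = enum-all? ∈-assignments λ a →
    map′ (λ (f , g) → mk⇔ f g) (λ e → Equivalence.to e , Equivalence.from e)
      ((sat? (I ∖ C) a →-dec sat? I a) ×-dec (sat? I a →-dec sat? (I ∖ C) a))

  -- Redundant constraints go one at a time, since removing one can make another indispensable. The
  -- bound `m` on the length drives the recursion.
  prune : ∀ m I → length I ≤ m → Unique I →
    ∃[ J ] Unique J × NonRedundant J × (∀ a → Sat J a ⇔ Sat I a)
  prune zero    []      _   _  = [] , [] , [] , λ a → ⇔-id _
  prune (suc m) I       len I! with nonRedundant? I
  ... | yes nr = I , I! , nr , λ a → ⇔-id _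
  ... | no ¬nr with find (All.¬All⇒Any¬ (λ C → ¬? (redundant? I C)) I ¬nr)
  ... | C , C∈I , ¬¬red =
    let J , J! , J-nr , J⇔I∖C = prune m (I ∖ C)
          (≤-pred (≤-trans (filter-notAll _ I (lose C∈I λ C≢C → C≢C refl)) len))
          (Unique.filter⁺ _ I!)
    in J , J! , J-nr , λ a → decidable-stable (redundant? I C) ¬¬red a ⇔-∘ J⇔I∖C a

  -- `NRD` bounds duplicate-free lists only, hence the deduplication before pruning.
  equivalent≤NRD : ∀ I → ∃[ J ] length J ≤ NRD × (∀ a → Sat J a ⇔ Sat I a)
  equivalent≤NRD I with prune _ (deduplicate _≟_ I) ≤-refl (deduplicate-! _≟_ I)
  ... | J , J! , J-nr , J⇔I = J , proj₂ NRD-isMaximum _ (J , J! , J-nr , refl) , λ a →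
    mk⇔ (λ sat → All.tabulate λ C∈I → All.lookup sat (∈-deduplicate⁺ _≟_ C∈I))
        (λ sat → All.tabulate λ C∈I → All.lookup sat (∈-deduplicate⁻ _≟_ I C∈I))
    ⇔-∘ J⇔I a

  space : ℕ
  space = NRD * constraintBits

  decode : Memory space → Instance
  decode = blocks allConstraints NRD

  encode : ∀ I → ∃[ μ ] (∀ a → Sat (decode μ) a ⇔ Sat I a)
  encode I with equivalent≤NRD I
  ... | J , J≤ , J⇔I with blocks-surjective length-allConstraints< ∈-allConstraints NRD J J≤
  ... | μ , μ≡J = μ , subst (λ J → ∀ a → Sat J a ⇔ Sat I a) (sym μ≡J) J⇔I

  algorithm : DeterministicAlgorithm space
  algorithm = record
    { start  = proj₁ (encode [])
    ; step   = λ μ C → proj₁ (encode (C ∷ decode μ))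
    ; output = λ μ → does (satisfiable? (decode μ))
    }

  open DeterministicAlgorithm algorithm

  -- The loop invariant: re-encoding may change the stored constraints but never their solutions.
  -- The initial memory is arbitrary for the induction.
  foldl-step : ∀ I μ a → Sat (decode (foldl step μ I)) a ⇔ (Sat (decode μ) a × Sat I a)
  foldl-step []      μ a = mk⇔ (λ sat → sat , []) proj₁
  foldl-step (C ∷ I) μ a = mk⇔
    (λ sat → let sat-μ′ , sat-I = to (foldl-step I (step μ C) a) sat in
             case to (proj₂ (encode (C ∷ decode μ)) a) sat-μ′ of λ { (c ∷ sat-μ) → sat-μ , c ∷ sat-I })
    (λ { (sat-μ , c ∷ sat-I) → from (foldl-step I (step μ C) a)
           (from (proj₂ (encode (C ∷ decode μ)) a) (c ∷ sat-μ) , sat-I) })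
    where open Equivalence

  algorithm-correct : Correct
  algorithm-correct I = does-⇔ (mk⇔
      (λ (a , sat) → a , proj₂ (to (foldl-step I start a) sat))
      (λ (a , sat) → a , from (foldl-step I start a) (from (proj₂ (encode []) a) [] , sat)))
    (satisfiable? _) (satisfiable? I)
    where open Equivalence

space-is-O : ∀ {q k} (Γ : Language q k) → space Γ is-O (λ n → CSP.NRD Γ n * ⌈log₂ n ⌉)
-- From `n = 2` on the logarithm is at least 1, so multiplying the constant part by it only
-- increases the bound.
space-is-O {q} {k} Γ = σ + (1 + q) * k , 2 , λ n 2≤n → let N = CSP.NRD Γ n; L = ⌈log₂ n ⌉ in begin
  N * (σ + (L + q) * k)                     ≤⟨ *-monoʳ-≤ N (bits (⌈log₂⌉-mono-≤ 2≤n)) ⟩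
  N * ((σ + (1 + q) * k) * L)               ≡⟨ swap N (σ + (1 + q) * k) L ⟩
  (σ + (1 + q) * k) * (N * L)               ∎
  where
  open ≤-Reasoning
  σ = size Γ
  swap : ∀ x y z → x * (y * z) ≡ y * (x * z)
  swap = solve-∀
  expand : ∀ σ q k l → (σ + (1 + q) * k) * (1 + l) ≡ σ + (1 + l + q) * k + (σ + q * k) * l
  expand = solve-∀
  bits : ∀ {L} → 1 ≤ L → σ + (L + q) * k ≤ (σ + (1 + q) * k) * L
  bits {suc l} _ = ≤-trans (m≤m+n _ ((σ + q * k) * l)) (≤-reflexive (sym (expand σ q k l)))

theorem1p1 : (q k : ℕ) → 2 ≤ q → 1 ≤ k → (Γ : Language q k) → NonTrivial Γ →
    (Σ[ s ∈ (ℕ → ℕ) ] Σ[ A ∈ (∀ n → CSP.DeterministicAlgorithm Γ n (s n)) ]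
    (∀ n → CSP.DeterministicAlgorithm.Correct (A n)) ×
    s is-O (λ n → CSP.NRD Γ n * ⌈log₂ n ⌉))
    ×
    (∀ (s : ℕ → ℕ) (A : ∀ n → CSP.RandomizedAlgorithm Γ n (s n)) →
    (∀ n → CSP.RandomizedAlgorithm.Succeeds (A n)) →
    ¬ (s is-o CSP.NRD Γ))
theorem1p1 (suc p) k 2≤q 1≤k Γ nt =
  (space Γ , algorithm Γ , algorithm-correct Γ , space-is-O Γ) ,
  -- 27 exceeds the 26 of `NRD≤26*space`, so the two bounds force zero space, against
  -- `positive-space`. The choice `suc n₀` is beyond the threshold and also positive.
  λ s A succeeds s-is-o → let n₀ , small = s-is-o 27
                              n = suc n₀
    in contradiction (positive-space nt (A n) (succeeds n)) (too-small (s n)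
         (≤-trans (small n (n≤1+n n₀)) (NRD≤26*space nt (A n) (succeeds n))))
  where
  too-small : ∀ s → 27 * s ≤ 26 * s → ¬ 1 ≤ 25 * s
  too-small (suc s) le _ = <⇒≱ (*-monoˡ-< (suc s) {26} ≤-refl) le
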